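{- Let $(\Omega,\star)$ be a nonempty associative semigroup, and let $\mathbf{EDS}(\Omega,\star,\star)$ be the set $\Omega$ with the four operations $\alpha\leftarrow\beta=\alpha\rightarrow\beta=\alpha\star\beta$, $\alpha\triangleleft\beta=\beta$, $\alpha\triangleright\beta=\alpha$ (this is an extended diassociative semigroup). The following conditions are equivalent: 1. $\mathbf{EDS}(\Omega,\star,\star)$ is nondegenerate. 2. For $\mathbf{EDS}(\Omega,\star,\star)$, the maps $\varphi_\leftarrow$ and $\varphi_\rightarrow$ are surjective. 3. $(\Omega,\star)$ is a group. If this holds, then for any $\alpha,\beta\in\Omega$: $$\alpha\curvearrowleft\beta=\alpha\star\beta^{ -1},\quad\alpha\curvearrowright\beta=\alpha^{ -1}\star\beta,\quad\alpha\blacktriangleleft\beta=\beta,\quad\alpha\blacktriangleright\beta=\alpha.$$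
   Context: For a set $\Omega$ with four binary operations $\leftarrow,\rightarrow,\triangleleft,\triangleright$ (here an extended diassociative semigroup), define $\varphi_\leftarrow,\varphi_\rightarrow:\Omega^2\to\Omega^2$ by $\varphi_\leftarrow(\alpha,\beta)=(\alpha\leftarrow\beta,\alpha\triangleleft\beta)$ and $\varphi_\rightarrow(\alpha,\beta)=(\alpha\rightarrow\beta,\alpha\triangleright\beta)$. $\Omega$ is nondegenerate if both maps are bijective. In that case the operations $\curvearrowleft,\blacktriangleleft,\curvearrowright,\blacktriangleright$ on $\Omega$ are defined by $\varphi_\leftarrow^{ -1}(\alpha,\beta)=(\alpha\curvearrowleft\beta,\alpha\blacktriangleleft\beta)$ and $\varphi_\rightarrow^{ -1}(\alpha,\beta)=(\beta\blacktriangleright\alpha,\beta\curvearrowright\alpha)$. -}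

module Defs where

open import Algebra.Bundles using (Semigroup)
open import Algebra.Core using (Op₂)
open import Algebra.Definitions using (Congruent₂)
open import Data.Product using (_×_; _,_; proj₁; proj₂)
open import Data.Product.Relation.Binary.Pointwise.NonDependent using (Pointwise)
open import Function.Base using (_∘_)
open import Function.Definitions using (Bijective; Surjective)
open import Level using (Level; suc; _⊔_)
open import Relation.Binary.Core using (Rel)
open import Relation.Binary.Structures using (IsEquivalence)

-- As for the algebraic bundles of the standard library, the equality on the
-- underlying set is a setoid equality respected by all operations.

record IsDiassociativeSemigroup {c ℓ : Level} {Ω : Set c} (_≈_ : Rel Ω ℓ)
                                (_←_ _⇀_ : Op₂ Ω) : Set (c ⊔ ℓ) where
  field
    isEquivalence : IsEquivalence _≈_
    ←-cong        : Congruent₂ _≈_ _←_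
    ⇀-cong        : Congruent₂ _≈_ _⇀_
    ←←-assoc      : ∀ α β γ → ((α ← β) ← γ) ≈ (α ← (β ← γ))
    ←⇀-assoc      : ∀ α β γ → (α ← (β ← γ)) ≈ (α ← (β ⇀ γ))
    ⇀←-assoc      : ∀ α β γ → ((α ⇀ β) ← γ) ≈ (α ⇀ (β ← γ))
    ⇀⇀-assoc      : ∀ α β γ → ((α ⇀ β) ⇀ γ) ≈ ((α ← β) ⇀ γ)
    ←⇀-⇀⇀-assoc   : ∀ α β γ → ((α ← β) ⇀ γ) ≈ (α ⇀ (β ⇀ γ))

record DiassociativeSemigroup (c ℓ : Level) : Set (suc (c ⊔ ℓ)) where
  infix 4 _≈_
  field
    Carrier                  : Set c
    _≈_                      : Rel Carrier ℓ
    -- "→" is reserved by Agda, hence "⇀".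
    _←_                      : Op₂ Carrier
    _⇀_                      : Op₂ Carrier
    isDiassociativeSemigroup : IsDiassociativeSemigroup _≈_ _←_ _⇀_

  open IsDiassociativeSemigroup isDiassociativeSemigroup public

record IsEDS {c ℓ : Level} {Ω : Set c} (_≈_ : Rel Ω ℓ)
             (_←_ _⇀_ _◁_ _▷_ : Op₂ Ω) : Set (c ⊔ ℓ) where
  field
    isDiassociativeSemigroup : IsDiassociativeSemigroup _≈_ _←_ _⇀_
    ◁-cong : Congruent₂ _≈_ _◁_
    ▷-cong : Congruent₂ _≈_ _▷_
    ▷-←    : ∀ α β γ → (α ▷ (β ← γ)) ≈ (α ▷ β)
    ⇀-◁    : ∀ α β γ → ((α ⇀ β) ◁ γ) ≈ (β ◁ γ)
    ◁←◁    : ∀ α β γ → ((α ◁ β) ← ((α ← β) ◁ γ)) ≈ (α ◁ (β ← γ))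
    ◁◁◁    : ∀ α β γ → ((α ◁ β) ◁ ((α ← β) ◁ γ)) ≈ (β ◁ γ)
    ◁⇀◁    : ∀ α β γ → ((α ◁ β) ⇀ ((α ← β) ◁ γ)) ≈ (α ◁ (β ⇀ γ))
    ◁▷◁    : ∀ α β γ → ((α ◁ β) ▷ ((α ← β) ◁ γ)) ≈ (β ▷ γ)
    ▷←▷    : ∀ α β γ → ((α ▷ (β ⇀ γ)) ← (β ▷ γ)) ≈ ((α ← β) ▷ γ)
    ▷◁▷    : ∀ α β γ → ((α ▷ (β ⇀ γ)) ◁ (β ▷ γ)) ≈ (α ◁ β)
    ▷⇀▷    : ∀ α β γ → ((α ▷ (β ⇀ γ)) ⇀ (β ▷ γ)) ≈ ((α ⇀ β) ▷ γ)
    ▷▷▷    : ∀ α β γ → ((α ▷ (β ⇀ γ)) ▷ (β ▷ γ)) ≈ (α ▷ β)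

  open IsDiassociativeSemigroup isDiassociativeSemigroup public

record ExtendedDiassociativeSemigroup (c ℓ : Level) : Set (suc (c ⊔ ℓ)) where
  infix 4 _≈_
  field
    Carrier : Set c
    _≈_     : Rel Carrier ℓ
    _←_     : Op₂ Carrier
    _⇀_     : Op₂ Carrier
    _◁_     : Op₂ Carrier
    _▷_     : Op₂ Carrier
    isEDS   : IsEDS _≈_ _←_ _⇀_ _◁_ _▷_

  open IsEDS isEDS public

EDS : {c ℓ : Level} → DiassociativeSemigroup c ℓ → ExtendedDiassociativeSemigroup c ℓ
EDS D = record
  { Carrier = Carrier
  ; _≈_     = _≈_
  ; _←_     = _←_
  ; _⇀_     = _⇀_
  ; _◁_     = λ α β → β
  ; _▷_     = λ α β → α
  ; isEDS   = record
    { isDiassociativeSemigroup = isDiassociativeSemigroup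
    ; ◁-cong = λ _ q → q
    ; ▷-cong = λ p _ → p
    ; ▷-←    = λ _ _ _ → refl
    ; ⇀-◁    = λ _ _ _ → refl
    ; ◁←◁    = λ _ _ _ → refl
    ; ◁◁◁    = λ _ _ _ → refl
    ; ◁⇀◁    = λ _ _ _ → refl
    ; ◁▷◁    = λ _ _ _ → refl
    ; ▷←▷    = λ _ _ _ → refl
    ; ▷◁▷    = λ _ _ _ → refl
    ; ▷⇀▷    = λ _ _ _ → refl
    ; ▷▷▷    = λ _ _ _ → refl
    }
  }
  where
  open DiassociativeSemigroup D
  open IsEquivalence isEquivalence using (refl)

-- The diassociative semigroup (Ω, ∙, ∙).
diagonal : {c ℓ : Level} → Semigroup c ℓ → DiassociativeSemigroup c ℓ
diagonal S = record
  { Carrier = Carrier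
  ; _≈_     = _≈_
  ; _←_     = _∙_
  ; _⇀_     = _∙_
  ; isDiassociativeSemigroup = record
    { isEquivalence = isEquivalence
    ; ←-cong        = ∙-cong
    ; ⇀-cong        = ∙-cong
    ; ←←-assoc      = assoc
    ; ←⇀-assoc      = λ _ _ _ → refl
    ; ⇀←-assoc      = assoc
    ; ⇀⇀-assoc      = λ _ _ _ → refl
    ; ←⇀-⇀⇀-assoc   = assoc
    }
  }
  where open Semigroup S

module _ {c ℓ : Level} (E : ExtendedDiassociativeSemigroup c ℓ) where

  open ExtendedDiassociativeSemigroup E

  infix 4 _≈²_

  _≈²_ : Rel (Carrier × Carrier) ℓ
  _≈²_ = Pointwise _≈_ _≈_

  φ← : Carrier × Carrier → Carrier × Carrier
  φ← (α , β) = α ← β , α ◁ β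

  φ⇀ : Carrier × Carrier → Carrier × Carrier
  φ⇀ (α , β) = α ⇀ β , α ▷ β

  Nondegenerate : Set (c ⊔ ℓ)
  Nondegenerate = Bijective _≈²_ _≈²_ φ← × Bijective _≈²_ _≈²_ φ⇀

  φ-Surjective : Set (c ⊔ ℓ)
  φ-Surjective = Surjective _≈²_ _≈²_ φ← × Surjective _≈²_ _≈²_ φ⇀

module InverseOperations {c ℓ : Level} (E : ExtendedDiassociativeSemigroup c ℓ)
                         (nondegenerate : Nondegenerate E) where

  open ExtendedDiassociativeSemigroup E

  φ←⁻¹ : Carrier × Carrier → Carrier × Carrier
  φ←⁻¹ = proj₁ ∘ proj₂ (proj₁ nondegenerate)

  φ⇀⁻¹ : Carrier × Carrier → Carrier × Carrier
  φ⇀⁻¹ = proj₁ ∘ proj₂ (proj₂ nondegenerate)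

  _↶_ : Op₂ Carrier
  α ↶ β = proj₁ (φ←⁻¹ (α , β))

  _◀_ : Op₂ Carrier
  α ◀ β = proj₂ (φ←⁻¹ (α , β))

  -- The arguments are swapped: φ⇀⁻¹ (α , β) = (β ▶ α , β ↷ α).
  _↷_ : Op₂ Carrier
  α ↷ β = proj₂ (φ⇀⁻¹ (β , α))

  _▶_ : Op₂ Carrier
  α ▶ β = proj₁ (φ⇀⁻¹ (β , α))

module Submission where

open import Defs
open import Algebra.Bundles using (Semigroup; Group)
open import Algebra.Definitions using (LeftDividesˡ; RightDividesˡ)
import Algebra.Consequences.Setoid as Consequences
import Algebra.Properties.Group as GroupProperties
open import Algebra.Structures using (IsGroup)
open import Data.Product using (_×_; ∃; ∃₂; _,_; proj₁; proj₂; map)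
open import Function.Bundles using (_⇔_; mk⇔)
open import Level using (Level)
import Relation.Binary.Reasoning.Setoid as ≈-Reasoning

-- The second component of φ← (α , β) is β and that of φ⇀ (α , β) is α, so
-- surjectivity of φ← and φ⇀ says precisely that the equations x ∙ β ≈ α and
-- β ∙ y ≈ α are solvable.  A nonempty semigroup with this property is a group,
-- and in a group the solutions are unique.

module _ {c ℓ : Level} (S : Semigroup c ℓ) where

  open Semigroup S renaming (Carrier to Ω)

  private
    E = EDS (diagonal S)

  surjective⇒leftDivides : φ-Surjective E → ∃ (LeftDividesˡ _≈_ _∙_)
  surjective⇒leftDivides (_ , surj⇀) =
      (λ α β → proj₂ (proj₁ (surj⇀ (β , α))))
    -- The preimage's first component `x` is only known to be `≈` to `α`, so it is exchanged for `α`
    -- by congruence.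
    , λ α β → let x∙y≈β , x≈α = proj₂ (surj⇀ (β , α)) (refl , refl)
              in trans (∙-congʳ (sym x≈α)) x∙y≈β

  surjective⇒rightDivides : φ-Surjective E → ∃ (RightDividesˡ _≈_ _∙_)
  surjective⇒rightDivides (surj← , _) =
      (λ β α → proj₁ (proj₁ (surj← (β , α))))
    , λ α β → let x∙y≈β , y≈α = proj₂ (surj← (β , α)) (refl , refl)
              in trans (∙-congˡ (sym y≈α)) x∙y≈β

  -- The element `e` is needed to produce an identity: the empty semigroup satisfies both
  -- divisibility conditions vacuously.
  divides⇒isGroup : Ω → ∃ (LeftDividesˡ _≈_ _∙_) → ∃ (RightDividesˡ _≈_ _∙_) →
                    ∃₂ λ ε _⁻¹ → IsGroup _≈_ _∙_ ε _⁻¹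
  divides⇒isGroup e (_\\_ , leftDivides) (_//_ , rightDivides) = ε , _⁻¹ , record
    { isMonoid = record
      { isSemigroup = isSemigroup
      ; identity    = identityˡ , identityʳ
      }
    ; inverse = inverseˡ , inverseʳ
    -- The chosen quotients are not known to respect `≈`, so congruence comes from uniqueness:
    -- `α ⁻¹` is also a left inverse of `β`.
    ; ⁻¹-cong = λ {α} {β} α≈β →
        inverseˡ-unique (α ⁻¹) β (trans (∙-congˡ (sym α≈β)) (inverseˡ α))
    }
    where
    open ≈-Reasoning setoid

    ε : Ω
    ε = e // e

    _⁻¹ : Ω → Ω
    α ⁻¹ = α \\ ε

    -- `ε` is chosen to fix `e` from the left, and every `α` has the form `e ∙ y`, so associativity
    -- carries this over to `α`.
    identityˡ : ∀ α → ε ∙ α ≈ α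
    identityˡ α = begin
      ε ∙ α              ≈⟨ ∙-congˡ (leftDivides e α) ⟨
      ε ∙ (e ∙ (e \\ α)) ≈⟨ assoc ε e (e \\ α) ⟨
      (ε ∙ e) ∙ (e \\ α) ≈⟨ ∙-congʳ (rightDivides e e) ⟩
      e ∙ (e \\ α)       ≈⟨ leftDivides e α ⟩
      α                  ∎

    e\\e-identityʳ : ∀ α → α ∙ (e \\ e) ≈ α
    e\\e-identityʳ α = begin
      α ∙ (e \\ e)              ≈⟨ ∙-congʳ (rightDivides e α) ⟨
      ((α // e) ∙ e) ∙ (e \\ e) ≈⟨ assoc (α // e) e (e \\ e) ⟩
      (α // e) ∙ (e ∙ (e \\ e)) ≈⟨ ∙-congˡ (leftDivides e e) ⟩
      (α // e) ∙ e              ≈⟨ rightDivides e α ⟩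
      α                         ∎

    -- The left identity `ε` and the right identity just found coincide, since their product equals
    -- both.
    identityʳ : ∀ α → α ∙ ε ≈ α
    identityʳ α = begin
      α ∙ ε              ≈⟨ ∙-congˡ (e\\e-identityʳ ε) ⟨
      α ∙ (ε ∙ (e \\ e)) ≈⟨ ∙-congˡ (identityˡ (e \\ e)) ⟩
      α ∙ (e \\ e)       ≈⟨ e\\e-identityʳ α ⟩
      α                  ∎

    inverseʳ : ∀ α → α ∙ (α ⁻¹) ≈ ε
    inverseʳ α = leftDivides α ε

    -- Multiply by `β ⁻¹` on the right. Only right inverses enter, so this is available before
    -- `inverseˡ`.
    inverseˡ-unique : ∀ α β → α ∙ β ≈ ε → α ≈ β ⁻¹
    inverseˡ-unique =
      Consequences.assoc∧id∧invʳ⇒invˡ-unique setoid {_⁻¹ = _⁻¹} ∙-cong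
        assoc (identityˡ , identityʳ) inverseʳ

    -- Right division supplies some left inverse `ε // α`; by uniqueness it agrees with the right
    -- inverse `α ⁻¹`.
    inverseˡ : ∀ α → (α ⁻¹) ∙ α ≈ ε
    inverseˡ α = begin
      (α ⁻¹) ∙ α   ≈⟨ ∙-congʳ (inverseˡ-unique (ε // α) α (rightDivides α ε)) ⟨
      (ε // α) ∙ α ≈⟨ rightDivides α ε ⟩
      ε            ∎

  surjective⇒isGroup : Ω → φ-Surjective E → ∃₂ λ ε _⁻¹ → IsGroup _≈_ _∙_ ε _⁻¹
  surjective⇒isGroup e surj =
    divides⇒isGroup e (surjective⇒leftDivides surj) (surjective⇒rightDivides surj)

  nondegenerate⇒surjective : Nondegenerate E → φ-Surjective E
  nondegenerate⇒surjective = map proj₂ proj₂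

  module _ {ε : Ω} {_⁻¹ : Ω → Ω} (isGroup : IsGroup _≈_ _∙_ ε _⁻¹) where

    private
      G : Group c ℓ
      G = record { isGroup = isGroup }

    open Group G using (_\\_; _//_)
    open GroupProperties G

    isGroup⇒nondegenerate : Nondegenerate E
    isGroup⇒nondegenerate = (φ←-injective , φ←-surjective)
                          , (φ⇀-injective , φ⇀-surjective)
      where
      φ←-injective : ∀ {p q} → _≈²_ E (φ← E p) (φ← E q) → _≈²_ E p q
      φ←-injective (eq , y≈y′) =
        ∙-cancelʳ _ _ _ (trans eq (∙-congˡ (sym y≈y′))) , y≈y′

      φ⇀-injective : ∀ {p q} → _≈²_ E (φ⇀ E p) (φ⇀ E q) → _≈²_ E p q
      φ⇀-injective (eq , x≈x′) =
        x≈x′ , ∙-cancelˡ _ _ _ (trans eq (∙-congʳ (sym x≈x′)))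

      φ←-surjective : ∀ q → ∃ λ p → ∀ {r} → _≈²_ E r p → _≈²_ E (φ← E r) q
      φ←-surjective (α , β) = (α // β , β) , λ (x≈ , y≈) →
        trans (∙-cong x≈ y≈) (//-rightDividesˡ β α) , y≈

      φ⇀-surjective : ∀ q → ∃ λ p → ∀ {r} → _≈²_ E r p → _≈²_ E (φ⇀ E r) q
      φ⇀-surjective (α , β) = (β , β \\ α) , λ (x≈ , y≈) →
        trans (∙-cong x≈ y≈) (\\-leftDividesˡ β α) , x≈

    module _ (nondegenerate : Nondegenerate E) where

      open InverseOperations E nondegenerate

      -- The preimages come from an arbitrary witness of nondegeneracy, so only their defining
      -- equations are used; these are solved in the group.
      inverseOperations : ∀ α β → ((α ↶ β) ≈ (α ∙ (β ⁻¹)))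
                                × ((α ↷ β) ≈ ((α ⁻¹) ∙ β))
                                × ((α ◀ β) ≈ β)
                                × ((α ▶ β) ≈ α)
      inverseOperations α β =
        let (_ , surj←) , (_ , surj⇀) = nondegenerate
            ↶∙◀≈α , ◀≈β = proj₂ (surj← (α , β)) (refl , refl)
            -- Because of the swapped arguments, `(α ▶ β , α ↷ β)` is the preimage of `(β , α)`, not
            -- of `(α , β)`.
            ▶∙↷≈β , ▶≈α = proj₂ (surj⇀ (β , α)) (refl , refl)
        in x≈z//y _ _ _ (trans (∙-congˡ (sym ◀≈β)) ↶∙◀≈α)
         , y≈x\\z _ _ _ (trans (∙-congʳ (sym ▶≈α)) ▶∙↷≈β)
         , ◀≈β
         , ▶≈α

lemma7 : {c ℓ : Level} (S : Semigroup c ℓ) →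
    let open Semigroup S renaming (Carrier to Ω)
        E = EDS (diagonal S)
    in
    (nonempty : Ω) →
      (Nondegenerate E ⇔ φ-Surjective E)
    × (φ-Surjective E ⇔ (∃₂ λ ε _⁻¹ → IsGroup _≈_ _∙_ ε _⁻¹))
    × ((nondegenerate : Nondegenerate E) (ε : Ω) (_⁻¹ : Ω → Ω) →
       IsGroup _≈_ _∙_ ε _⁻¹ →
       let open InverseOperations E nondegenerate in
       ∀ (α β : Ω) →
         ((α ↶ β) ≈ (α ∙ (β ⁻¹)))
       × ((α ↷ β) ≈ ((α ⁻¹) ∙ β))
       × ((α ◀ β) ≈ β)
       × ((α ▶ β) ≈ α))
lemma7 S nonempty =
    mk⇔ (nondegenerate⇒surjective S)
        -- Injectivity is obtained by passing through the group structure, where cancellation holds.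
        (λ surj → isGroup⇒nondegenerate S
                    (proj₂ (proj₂ (surjective⇒isGroup S nonempty surj))))
  , mk⇔ (surjective⇒isGroup S nonempty)
        (λ (_ , _ , isGroup) →
          nondegenerate⇒surjective S (isGroup⇒nondegenerate S isGroup))
  , λ nondegenerate _ _ isGroup → inverseOperations S isGroup nondegenerate
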